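{- Fix an integer $c\geq 2$, a positive integer $n$, and positive integers $e_1,\dots,e_n$. Let $u=I_{c}^{e_{1}}D_{c}^{e_{2}}I_{c}^{e_{3}}\ldots \mathcal{L}_{c}^{e_{n}}$, where $\mathcal{L}$ is $I$ if $n$ is odd and $D$ if $n$ is even. Define $A= \sum_{i\geq 1}e_{2i-1}$ and $B = \sum_{i\geq 1}e_{2i}$, $M= \max(A, B)$ and $m= \min(A, B)$. Then $$(c-1)m+M+ \lfloor n/2\rfloor\leq \mathit{fw}(u)\leq 2(c-1)m+2M+2\lfloor n/2\rfloor-1.$$
   Context: Sequences are finite words over an alphabet of letters. A sequence $s$ contains a sequence $u$ if some subsequence (not necessarily contiguous) of $s$ can be changed into $u$ by a one-to-one renaming of its letters; otherwise $s$ avoids $u$. An $(r,s)$-formation is a concatenation of $s$ permutations of the same set of $r$ distinct letters. The formation width $\mathit{fw}(u)$ of a sequence $u$ is the minimum $s$ such that there exists $r$ for which every $(r,s)$-formation contains $u$. $I_c$ denotes the sequence $1\,2\ldots c$ and $D_c$ the sequence $c\,(c-1)\ldots 1$; powers denote repeated concatenation. -}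

module Defs where

open import Data.Nat using (ℕ; zero; suc; _<_; _⊔_; _⊓_)
open import Data.Bool using (Bool; true; false; if_then_else_)
open import Data.Fin using (Fin; toℕ)
open import Data.List using (List; []; _∷_; map; concat; replicate; reverse; upTo; length; tabulate)
open import Data.Nat.ListAction using (sum)
open import Data.List.Membership.Propositional using (_∈_)
open import Data.List.Relation.Unary.All using (All)
open import Data.List.Relation.Unary.Unique.Propositional using (Unique)
open import Data.List.Relation.Binary.Sublist.Propositional using (_⊆_)
open import Data.List.Relation.Binary.Permutation.Propositional using (_↭_)
open import Data.Product using (Σ; ∃; _×_)
open import Relation.Binary.PropositionalEquality using (_≡_)
open import Relation.Nullary using (¬_)

Seq : Set
Seq = List ℕ

Contains : Seq → Seq → Set
Contains s u =
  Σ Seq λ t → (t ⊆ s) ×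
    Σ (ℕ → ℕ) λ f →
      (∀ {x y} → x ∈ t → y ∈ t → f x ≡ f y → x ≡ y) × (map f t ≡ u)

Avoids : Seq → Seq → Set
Avoids s u = ¬ Contains s u

IsFormation : ℕ → ℕ → Seq → Set
IsFormation r s w =
  Σ (List ℕ) λ L → (length L ≡ r) × Unique L ×
    Σ (List Seq) λ ps → (length ps ≡ s) × All (λ p → p ↭ L) ps × (w ≡ concat ps)

FormationForced : Seq → ℕ → Set
FormationForced u s = ∃ λ r → ∀ w → IsFormation r s w → Contains w u

IsFormationWidth : Seq → ℕ → Set
IsFormationWidth u k = FormationForced u k × (∀ s → s < k → ¬ FormationForced u s)

I : ℕ → Seq
I c = map suc (upTo c)

D : ℕ → Seq
D c = reverse (I c)

pow : Seq → ℕ → Seq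
pow w e = concat (replicate e w)

isEven : ℕ → Bool
isEven zero = true
isEven (suc n) = if isEven n then false else true

-- u = I_c^{e_1} D_c^{e_2} I_c^{e_3} …  (Fin index i is the 0-based position,
-- so block i (0-based) uses I when i is even, D when i is odd)
altSeq : ℕ → (n : ℕ) → (Fin n → ℕ) → Seq
altSeq c n e = concat (tabulate λ i → if isEven (toℕ i) then pow (I c) (e i) else pow (D c) (e i))

-- A = e_1 + e_3 + … (0-based even positions), B = e_2 + e_4 + …
sumA : (n : ℕ) → (Fin n → ℕ) → ℕ
sumA n e = sum (tabulate λ i → if isEven (toℕ i) then e i else 0)

sumB : (n : ℕ) → (Fin n → ℕ) → ℕ
sumB n e = sum (tabulate λ i → if isEven (toℕ i) then 0 else e i)

{-# OPTIONS --safe #-}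
module Submission where

-- By Ramsey's theorem, every formation with s blocks on enough letters contains
-- a binary one, i.e. a word in I_c and D_c with s factors; conversely a
-- formation built from I_r and D_r only uses, on the letters of a copy of u, a
-- binary formation on c letters.  So s blocks force u iff each of the finitely
-- many binary formations on c letters contains u, a decidable condition.
--
-- A word v embeds in I_c^N iff it has fewer than N weak descents.  If the order
-- of the letters turns I_c cyclically into a word with d descents, its reversal
-- has c − d, so u needs A d + B (c − d) factors, plus one for each block
-- of one of the two kinds.  This is at least X = (c−1)m + M + ⌊n/2⌋, which is
-- the lower bound, and the orders 1 2 … c and 1 c … 2 attain X.  Finally, among
-- 2X − 1 factors, X are equal to I_c or X are equal to D_c.

open import Defs
open import Data.Nat using (ℕ; zero; suc; z≤n; s≤s; _≤_; _<_; _+_; _*_; _∸_; _⊔_; _⊓_; _≟_;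
  _≤?_; _<?_; ⌊_/2⌋; ⌈_/2⌉)
open import Data.Bool using (Bool; true; false; if_then_else_)
open import Data.Fin as Fin using (Fin; toℕ)
open import Data.List using (List; []; _∷_; _++_; [_]; applyUpTo; concat; drop; filter; length;
  map; replicate; reverse; tabulate; take; upTo)
open import Data.List.Membership.DecPropositional _≟_ using (_∈?_)
open import Data.List.Membership.Propositional using (_∈_)
open import Data.List.Membership.Propositional.Properties using (∈-++⁺ˡ; ∈-++⁻; ∈-filter⁺;
  ∈-filter⁻; ∈-map⁺; ∈-map⁻; ∈-upTo⁺; ∈-upTo⁻)
open import Data.List.Membership.Propositional.Properties.WithK using (unique∧set⇒bag)
open import Data.List.Properties using (∷-injectiveˡ; ∷-injectiveʳ; ++-identityʳ; drop-all;
  filter-++; filter-all; length-applyUpTo; length-map; length-replicate; length-reverse;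
  length-tabulate; length-take; length-upTo; map-++; map-∘; map-applyUpTo; map-upTo;
  reverse-involutive; reverse-map; tabulate-cong; unfold-reverse)
open import Data.List.Relation.Binary.BagAndSetEquality using (∼bag⇒↭)
open import Data.List.Relation.Binary.Permutation.Propositional using (_↭_; ↭-refl; ↭-sym; ↭⇒↭ₛ)
open import Data.List.Relation.Binary.Permutation.Propositional.Properties using (∈-resp-↭;
  ↭-length; ↭-reverse)
import Data.List.Relation.Binary.Permutation.Setoid.Properties as Permutation
open import Data.List.Relation.Binary.Pointwise as Pointwise using (Pointwise; []; _∷_)
open import Data.List.Relation.Binary.Sublist.DecPropositional _≟_ using (_⊆?_)
open import Data.List.Relation.Binary.Sublist.Propositional using (_⊆_; []; _∷_; _∷ʳ_; ⊆-refl;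
  ⊆-reflexive; ⊆-trans; from∈; lookup; minimum; to∈)
import Data.List.Relation.Binary.Sublist.Propositional.Properties as Sublist
open import Data.List.Relation.Unary.All as All using (All; []; _∷_)
import Data.List.Relation.Unary.All.Properties as Allₚ
open import Data.List.Relation.Unary.AllPairs as AllPairs using (AllPairs; []; _∷_)
open import Data.List.Relation.Unary.Any using (here; there)
open import Data.List.Relation.Unary.Unique.Propositional using (Unique)
import Data.List.Relation.Unary.Unique.Propositional.Properties as Unique
open import Data.Nat.DivMod using (_/_; m/n≡1+[m∸n]/n)
open import Data.Nat.ListAction using (sum)
open import Data.Nat.Properties using (*-comm; *-identityʳ; *-monoˡ-≤; +-assoc; +-cancelʳ-≡;
  +-cancelˡ-≡; +-comm; +-identityʳ; +-mono-<; +-mono-≤; +-monoʳ-≤; +-monoˡ-≤; +-suc; +-∸-assoc;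
  <-trans; <⇒≢; <⇒≤; <⇒≱; m+1+n≢0; m+n∸n≡m; m<n⇒m<1+n; m∸n≤m; m≤m+n; m≤n+m∸n; m≤n⇒m≤1+n;
  m≤n⇒m⊓n≡m; m≤n⇒m⊔n≡n; m≥n⇒m⊓n≡n; m≥n⇒m⊔n≡m; n≤0⇒n≡0; n≤1+n; ∸-cancelˡ-≡; ∸-monoʳ-≤; ≤-refl;
  ≤-reflexive; ≤-total; ≤-trans; ≤⇒≯; ≤∧≢⇒<; ⌊n/2⌋≤⌈n/2⌉; suc-injective; ≰⇒>; ≮⇒≥;
  module ≤-Reasoning)
open import Data.Nat.Tactic.RingSolver using (solve-∀)
open import Data.Product using (∃; _×_; _,_; proj₂; swap)
open import Data.Sum as Sum using (_⊎_; inj₁; inj₂; [_,_]′)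
open import Function using (_∘_; id; flip; mk⇔)
open import Relation.Binary.PropositionalEquality using (_≡_; _≢_; refl; sym; trans; cong;
  cong₂; subst; subst₂; setoid; module ≡-Reasoning)
open import Relation.Nullary using (¬_; Dec; yes; no; contradiction)
open import Relation.Nullary.Decidable as Dec using (_×-dec_; _⊎-dec_; _→-dec_; ¬?)

-- Renamings and decidability of containment

InjectiveOn : (ℕ → ℕ) → Seq → Set
InjectiveOn f t = ∀ {x y} → x ∈ t → y ∈ t → f x ≡ f y → x ≡ y

-- Containment read in the other direction: the renaming maps u into w.
Embeds : Seq → Seq → Set
Embeds w u = ∃ λ g → InjectiveOn g u × map g u ⊆ w

Compatible : ℕ → ℕ → ℕ → ℕ → Set
Compatible x y x′ y′ = (x ≡ x′ → y ≡ y′) × (y ≡ y′ → x ≡ x′)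

-- A renaming is a function on all of ℕ and cannot be searched for. The pattern of equalities
-- between positions is a decidable and symmetric substitute: each entry is compared with all later
-- ones.
data SamePattern : Seq → Seq → Set where
  []  : SamePattern [] []
  _∷_ : ∀ {x y t u} → Pointwise (Compatible x y) t u → SamePattern t u →
        SamePattern (x ∷ t) (y ∷ u)

SamePattern-sym : ∀ {t u} → SamePattern t u → SamePattern u t
SamePattern-sym []       = []
SamePattern-sym (c ∷ cs) = Pointwise.symmetric swap c ∷ SamePattern-sym cs

SamePattern-map : ∀ {f} t → InjectiveOn f t → SamePattern t (map f t)
SamePattern-map []      inj = []
SamePattern-map {f} (x ∷ t) inj =
  compatible t (λ z∈t → cong f , inj (here refl) (there z∈t)) ∷
  SamePattern-map t (λ x∈t y∈t → inj (there x∈t) (there y∈t))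
  where
  compatible : ∀ zs → (∀ {z} → z ∈ zs → Compatible x (f x) z (f z)) →
               Pointwise (Compatible x (f x)) zs (map f zs)
  compatible []       h = []
  compatible (z ∷ zs) h = h (here refl) ∷ compatible zs (h ∘ there)

SamePattern-unique : ∀ {t u} → Unique t → Unique u → length t ≡ length u → SamePattern t u
SamePattern-unique []       []       eq = []
SamePattern-unique (px ∷ p) (qx ∷ q) eq =
  compatible px qx (suc-injective eq) ∷ SamePattern-unique p q (suc-injective eq)
  where
  compatible : ∀ {x y t u} → All (x ≢_) t → All (y ≢_) u → length t ≡ length u →
               Pointwise (Compatible x y) t u
  compatible []       []       eq = []
  compatible (p ∷ ps) (q ∷ qs) eq =
    ((λ e → contradiction e p) , (λ e → contradiction e q)) ∷ compatible ps qs (suc-injective eq)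

samePattern? : ∀ t u → Dec (SamePattern t u)
samePattern? []      []      = yes []
samePattern? []      (_ ∷ _) = no λ ()
samePattern? (_ ∷ _) []      = no λ ()
samePattern? (x ∷ t) (y ∷ u) =
  Dec.map′ (λ (c , cs) → c ∷ cs) (λ { (c ∷ cs) → c , cs })
    (Pointwise.decidable
       (λ x′ y′ → ((x ≟ x′) →-dec (y ≟ y′)) ×-dec ((y ≟ y′) →-dec (x ≟ x′))) t u
     ×-dec samePattern? t u)

update : (ℕ → ℕ) → ℕ → ℕ → ℕ → ℕ
update f x y z with z ≟ x
... | yes _ = y
... | no  _ = f z

update-same : ∀ f x y → update f x y x ≡ y
update-same f x y with x ≟ x
... | yes _  = refl
... | no x≢x = contradiction refl x≢x

-- If `x` occurs in `t`, compatibility says that its image is `y` already, so the update changes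
-- nothing there.
map-update : ∀ f {x y} t → Pointwise (Compatible x y) t (map f t) →
             map (update f x y) t ≡ map f t
map-update f []      [] = refl
map-update f {x} (z ∷ t) ((x≡z⇒y≡fz , _) ∷ cs) with z ≟ x
... | yes z≡x = cong₂ _∷_ (x≡z⇒y≡fz (sym z≡x)) (map-update f t cs)
... | no  _   = cong (_ ∷_) (map-update f t cs)

relabelling : ∀ {t u} → SamePattern t u → ∃ λ f → map f t ≡ u
relabelling []       = id , refl
relabelling {x ∷ t} {y ∷ _} (c ∷ cs) with f , refl ← relabelling cs =
  update f x y , cong₂ _∷_ (update-same f x y) (map-update f t c)

map-fixes : ∀ {h : ℕ → ℕ} {t} → map h t ≡ t → ∀ {x} → x ∈ t → h x ≡ x
map-fixes eq (here refl) = ∷-injectiveˡ eq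
map-fixes eq (there x∈t) = map-fixes (∷-injectiveʳ eq) x∈t

leftInverse⇒injectiveOn : ∀ {f g t} → map g (map f t) ≡ t → InjectiveOn f t
leftInverse⇒injectiveOn {f} {g} {t} eq x∈t y∈t fx≡fy =
  trans (sym (fixes x∈t)) (trans (cong g fx≡fy) (fixes y∈t))
  where
  fixes : ∀ {x} → x ∈ t → g (f x) ≡ x
  fixes = map-fixes (trans (map-∘ t) eq)

-- The pattern relation is symmetric, so there is also a relabelling in the other direction; it is a
-- left inverse and yields injectivity.
injectiveRelabelling : ∀ {t u} → SamePattern t u → ∃ λ f → InjectiveOn f t × map f t ≡ u
injectiveRelabelling p with f , refl ← relabelling p | g , eq ← relabelling (SamePattern-sym p) =
  f , leftInverse⇒injectiveOn {g = g} eq , refl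

contains⇒pattern : ∀ {w u} → Contains w u → ∃ λ t → t ⊆ w × SamePattern t u
contains⇒pattern (t , t⊆w , f , inj , refl) = t , t⊆w , SamePattern-map t inj

pattern⇒contains : ∀ {w u} → (∃ λ t → t ⊆ w × SamePattern t u) → Contains w u
pattern⇒contains (t , t⊆w , p) = t , t⊆w , injectiveRelabelling p

contains⇒embeds : ∀ {w u} → Contains w u → Embeds w u
contains⇒embeds c with t , t⊆w , p ← contains⇒pattern c
  with g , inj , refl ← injectiveRelabelling (SamePattern-sym p) = g , inj , t⊆w

embeds⇒contains : ∀ {w u} → Embeds w u → Contains w u
embeds⇒contains {u = u} (g , inj , gu⊆w) =
  pattern⇒contains (map g u , gu⊆w , SamePattern-sym (SamePattern-map u inj))

Embeds-⊆ : ∀ {w w′ u} → w ⊆ w′ → Embeds w u → Embeds w′ u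
Embeds-⊆ w⊆w′ (g , inj , gu⊆w) = g , inj , ⊆-trans gu⊆w w⊆w′

Embeds-map : ∀ {h w u} → InjectiveOn h w → Embeds w u → Embeds (map h w) u
Embeds-map {h} {w} {u} injₕ (g , inj , gu⊆w) =
  h ∘ g ,
  (λ x∈u y∈u eq → inj x∈u y∈u (injₕ (g∈w x∈u) (g∈w y∈u) eq)) ,
  ⊆-trans (⊆-reflexive (map-∘ u)) (Sublist.map⁺ h gu⊆w)
  where
  g∈w : ∀ {x} → x ∈ u → g x ∈ w
  g∈w x∈u = lookup gu⊆w (∈-map⁺ g x∈u)

-- Decidable search over sublists and binary words

anySublist? : ∀ {P : Seq → Set} → (∀ t → Dec (P t)) → ∀ w → Dec (∃ λ t → t ⊆ w × P t)
anySublist? P? [] = Dec.map′ (λ p → [] , [] , p) (λ { (.[] , [] , p) → p }) (P? [])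
anySublist? P? (x ∷ w) =
  Dec.map′
    [ (λ (t , t⊆w , p) → t , x ∷ʳ t⊆w , p) , (λ (t , t⊆w , p) → x ∷ t , refl ∷ t⊆w , p) ]′
    (λ { (t , .x ∷ʳ t⊆w , p) → inj₁ (t , t⊆w , p)
       ; (.x ∷ t , refl ∷ t⊆w , p) → inj₂ (t , t⊆w , p) })
    (anySublist? P? w ⊎-dec anySublist? (P? ∘ (x ∷_)) w)

contains? : ∀ w u → Dec (Contains w u)
contains? w u = Dec.map′ pattern⇒contains contains⇒pattern (anySublist? (λ t → samePattern? t u) w)

allWords? : ∀ {P : List Bool → Set} → (∀ b → Dec (P b)) → ∀ s → Dec (∀ b → length b ≡ s → P b)
allWords? P? zero = Dec.map′ (λ { p [] refl → p }) (λ f → f [] refl) (P? [])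
allWords? P? (suc s) =
  Dec.map′
    (λ { (t , f) (true ∷ b) eq → t b (suc-injective eq)
       ; (t , f) (false ∷ b) eq → f b (suc-injective eq) })
    (λ h → (λ b eq → h (true ∷ b) (cong suc eq)) , (λ b eq → h (false ∷ b) (cong suc eq)))
    (allWords? (P? ∘ (true ∷_)) s ×-dec allWords? (P? ∘ (false ∷_)) s)

least : ∀ {P : ℕ → Set} → (∀ n → Dec (P n)) → ∀ m → P m →
        ∃ λ k → k ≤ m × P k × (∀ s → s < k → ¬ P s)
least P? zero    p = zero , z≤n , p , λ _ ()
least P? (suc m) p with P? zero
... | yes p₀ = zero , z≤n , p₀ , λ _ ()
... | no ¬p₀ with k , k≤m , pₖ , min ← least (P? ∘ suc) m p =
  suc k , s≤s k≤m , pₖ , λ { zero _ → ¬p₀ ; (suc s) (s≤s s<k) → min s s<k }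

-- Monotone restrictions of formations

AllPairs-resp-⊆ : ∀ {A : Set} {R : A → A → Set} {xs ys} → xs ⊆ ys → AllPairs R ys → AllPairs R xs
AllPairs-resp-⊆ []          []       = []
AllPairs-resp-⊆ (y ∷ʳ sub)  (_ ∷ ps) = AllPairs-resp-⊆ sub ps
AllPairs-resp-⊆ (refl ∷ sub) (p ∷ ps) = Sublist.All-resp-⊆ sub p ∷ AllPairs-resp-⊆ sub ps

Unique-resp-↭ : {xs ys : Seq} → xs ↭ ys → Unique xs → Unique ys
Unique-resp-↭ xs↭ys = Permutation.Unique-resp-↭ (setoid ℕ) (↭⇒↭ₛ xs↭ys)

+-≤-split : ∀ m n {p q} → m + n ≤ p + q → m ≤ p ⊎ n ≤ q
+-≤-split m n {p} {q} le with m ≤? p | n ≤? q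
... | yes m≤p | _       = inj₁ m≤p
... | no _    | yes n≤q = inj₂ n≤q
... | no m≰p  | no n≰q  = contradiction le (<⇒≱ (+-mono-< (≰⇒> m≰p) (≰⇒> n≰q)))

length-filter-¬ : ∀ {A : Set} {P : A → Set} (P? : ∀ x → Dec (P x)) xs →
                  length xs ≡ length (filter P? xs) + length (filter (¬? ∘ P?) xs)
length-filter-¬ P? [] = refl
length-filter-¬ P? (x ∷ xs) with P? x
... | yes _ = cong suc (length-filter-¬ P? xs)
... | no  _ = trans (cong suc (length-filter-¬ P? xs)) (sym (+-suc _ _))

-- The usual recursion for off-diagonal Ramsey numbers, with one more element for the vertex that is
-- set aside.
ramseyBound : ℕ → ℕ → ℕ
ramseyBound zero    _       = 0
ramseyBound (suc a) zero    = 0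
ramseyBound (suc a) (suc b) = suc (ramseyBound a (suc b) + ramseyBound (suc a) b)

module _ {A : Set} where

  Homogeneous : (A → A → Set) → List A → ℕ → Set
  Homogeneous R xs k = ∃ λ t → t ⊆ xs × length t ≡ k × AllPairs R t

  Homogeneous-⊆ : ∀ {R xs ys k} → xs ⊆ ys → Homogeneous R xs k → Homogeneous R ys k
  Homogeneous-⊆ xs⊆ys (t , t⊆xs , len , ps) = t , ⊆-trans t⊆xs xs⊆ys , len , ps

  Homogeneous-∷ : ∀ {R xs ys k x} → All (R x) ys → ys ⊆ xs →
                  Homogeneous R ys k → Homogeneous R (x ∷ xs) (suc k)
  Homogeneous-∷ r ys⊆xs (t , t⊆ys , len , ps) =
    _ ∷ t , refl ∷ ⊆-trans t⊆ys ys⊆xs , cong suc len , Sublist.All-resp-⊆ t⊆ys r ∷ ps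

  -- The first element `x` splits the rest into entries related to it and entries not related to it.
  -- One part is large enough to recurse, and `x` extends a sublist of the matching colour found
  -- there. Pairs are taken in list order, so `Precedes p`, which is not symmetric, can serve as the
  -- colouring.
  ramsey : ∀ {R : A → A → Set} → (∀ x y → Dec (R x y)) → ∀ a b xs → ramseyBound a b ≤ length xs →
           Homogeneous R xs a ⊎ Homogeneous (λ x y → ¬ R x y) xs b
  ramsey R? zero    b       xs le = inj₁ ([] , minimum xs , refl , [])
  ramsey R? (suc a) zero    xs le = inj₂ ([] , minimum xs , refl , [])
  ramsey R? (suc a) (suc b) (x ∷ xs) (s≤s le)
    with +-≤-split (ramseyBound a (suc b)) (ramseyBound (suc a) b)
           (subst (_ ≤_) (length-filter-¬ (R? x) xs) le)
  ... | inj₁ le₁ =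
    Sum.map (Homogeneous-∷ (Allₚ.all-filter (R? x) xs) (Sublist.filter-⊆ (R? x) xs))
            (Homogeneous-⊆ (x ∷ʳ Sublist.filter-⊆ (R? x) xs))
            (ramsey R? a (suc b) (filter (R? x) xs) le₁)
  ... | inj₂ le₂ =
    Sum.map (Homogeneous-⊆ (x ∷ʳ Sublist.filter-⊆ (¬? ∘ R? x) xs))
            (Homogeneous-∷ (Allₚ.all-filter (¬? ∘ R? x) xs) (Sublist.filter-⊆ (¬? ∘ R? x) xs))
            (ramsey R? (suc a) b (filter (¬? ∘ R? x) xs) le₂)

Precedes : Seq → ℕ → ℕ → Set
Precedes p x y = x ∷ y ∷ [] ⊆ p

Precedes-total : ∀ {p x y} → x ∈ p → y ∈ p → x ≢ y → Precedes p x y ⊎ Precedes p y x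
Precedes-total (here refl) (here refl) x≢y = contradiction refl x≢y
Precedes-total (here refl) (there y∈p) x≢y = inj₁ (refl ∷ from∈ y∈p)
Precedes-total (there x∈p) (here refl) x≢y = inj₂ (refl ∷ from∈ x∈p)
Precedes-total (there x∈p) (there y∈p) x≢y =
  Sum.map (_ ∷ʳ_) (_ ∷ʳ_) (Precedes-total x∈p y∈p x≢y)

-- The head `a` does not occur in `p`, so it cannot be the earlier letter of any of these pairs.
Precedes-tail : ∀ {a p T} → Unique (a ∷ p) → All (_∈ p) T →
                AllPairs (Precedes (a ∷ p)) T → AllPairs (Precedes p) T
Precedes-tail uniq []         []       = []
Precedes-tail uniq (y∈p ∷ ∈p) (y≺ ∷ ≺) =
  All.map (Sublist.∷ʳ⁻ λ { refl → Unique.Unique[x∷xs]⇒x∉xs uniq y∈p }) y≺ ∷ Precedes-tail uniq ∈p ≺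

-- Greedy matching along the word. If `T` starts with the head `a`, its other letters come later and
-- hence lie in `p`. If not, `x` lies in `p`, and so does everything that it precedes.
ordered⇒⊆ : ∀ {p} T → Unique p → All (_∈ p) T → AllPairs (Precedes p) T → T ⊆ p
ordered⇒⊆ {p}     []      _ _        _ = minimum p
ordered⇒⊆ {[]}    (x ∷ T) _ (() ∷ _) _
ordered⇒⊆ {a ∷ p} (x ∷ T) uniq@(_ ∷ uniq′) (x∈ap ∷ _) (x≺ ∷ T≺) with x ≟ a
... | yes refl = refl ∷ ordered⇒⊆ T uniq′ T∈p (Precedes-tail uniq T∈p T≺)
  where
  T∈p : All (_∈ p) T
  T∈p = All.map (to∈ ∘ Sublist.∷⁻) x≺
... | no x≢a = a ∷ʳ ordered⇒⊆ (x ∷ T) uniq′ xT∈p (Precedes-tail uniq xT∈p (x≺ ∷ T≺))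
  where
  ∈-tail : x ∈ a ∷ p → x ∈ p
  ∈-tail (here x≡a)  = contradiction x≡a x≢a
  ∈-tail (there x∈p) = x∈p
  xT∈p : All (_∈ p) (x ∷ T)
  xT∈p = ∈-tail x∈ap ∷ All.map (to∈ ∘ Sublist.∷ˡ⁻ ∘ Sublist.∷ʳ⁻ x≢a) x≺

orient : Bool → Seq → Seq
orient true  T = T
orient false T = reverse T

orient-⊆ : ∀ b {T T′} → T ⊆ T′ → orient b T ⊆ orient b T′
orient-⊆ true  = id
orient-⊆ false = Sublist.reverse⁺

binary : Seq → List Bool → Seq
binary T b = concat (map (λ β → orient β T) b)

-- A pair is coloured by whether `p` has it in the order of `L`. In a sublist of the negative colour
-- `p` has every pair in the opposite order, so the reversed sublist is found in `p`.
erdősSzekeres : ∀ k {p L} → Unique p → Unique L → All (_∈ p) L → ramseyBound k k ≤ length L →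
                ∃ λ T → T ⊆ L × length T ≡ k × ∃ λ β → orient β T ⊆ p
erdősSzekeres k {p} {L} uniqP uniqL L∈p le with ramsey (λ x y → x ∷ y ∷ [] ⊆? p) k k L le
... | inj₁ (T , T⊆L , len , ≺) =
  T , T⊆L , len , true , ordered⇒⊆ T uniqP (Sublist.All-resp-⊆ T⊆L L∈p) ≺
... | inj₂ (T , T⊆L , len , ⊀) =
  T , T⊆L , len , false ,
  subst (reverse T ⊆_) (reverse-involutive p)
    (Sublist.reverse⁺ (ordered⇒⊆ T (Unique-resp-↭ (↭-sym (↭-reverse p)) uniqP) (All.map ∈-reverse⁺ T∈p)
                                 (flipped T∈p (AllPairs-resp-⊆ T⊆L uniqL) ⊀)))
  where
  T∈p : All (_∈ p) T
  T∈p = Sublist.All-resp-⊆ T⊆L L∈p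
  ∈-reverse⁺ : ∀ {x} → x ∈ p → x ∈ reverse p
  ∈-reverse⁺ = ∈-resp-↭ (↭-sym (↭-reverse p))
  flipped : ∀ {T} → All (_∈ p) T → Unique T → AllPairs (λ x y → ¬ Precedes p x y) T →
            AllPairs (Precedes (reverse p)) T
  flipped []         []         []         = []
  flipped (x∈ ∷ T∈) (x≢ ∷ uniq) (x⊀ ∷ ⊀) =
    All.map (λ (y∈ , x≢y , x⊀y) → Sublist.reverse⁺ ([ flip contradiction x⊀y , id ]′ (Precedes-total x∈ y∈ x≢y)))
            (All.zip (T∈ , All.zip (x≢ , x⊀)))
    ∷ flipped T∈ uniq ⊀

-- One Ramsey step is spent on each block, and must leave enough letters for the blocks that remain.
formationBound : ℕ → ℕ → ℕ
formationBound c zero    = c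
formationBound c (suc s) = ramseyBound (formationBound c s) (formationBound c s)

-- The first block thins `L` to letters `T` on which it is monotone. The later blocks thin `T` to
-- `T′`, on which the first block is still monotone.
formation⊇binary : ∀ c {L ps} → Unique L → All (λ p → Unique p × All (_∈ p) L) ps →
                   formationBound c (length ps) ≤ length L →
                   ∃ λ T → T ⊆ L × length T ≡ c × ∃ λ b → length b ≡ length ps × binary T b ⊆ concat ps
formation⊇binary c {L} _ [] le =
  take c L , Sublist.take-⊆ c L , trans (length-take c L) (m≤n⇒m⊓n≡m le) , [] , refl , []
formation⊇binary c uniqL ((uniqP , L∈p) ∷ ps) le
  with T , T⊆L , len , β , Tβ⊆p ← erdősSzekeres _ uniqP uniqL L∈p le
  with T′ , T′⊆T , len′ , b , lenᵇ , T′b⊆ps ←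
       formation⊇binary c (AllPairs-resp-⊆ T⊆L uniqL)
         (All.map (λ (u , m) → u , Sublist.All-resp-⊆ T⊆L m) ps) (≤-reflexive (sym len)) =
  T′ , ⊆-trans T′⊆T T⊆L , len′ , β ∷ b , cong suc lenᵇ ,
  Sublist.++⁺ (⊆-trans (orient-⊆ β T′⊆T) Tβ⊆p) T′b⊆ps

-- Reduction to binary formations on `c` letters

I-unique : ∀ c → Unique (I c)
I-unique c = Unique.map⁺ suc-injective (Unique.upTo⁺ c)

length-I : ∀ c → length (I c) ≡ c
length-I c = trans (length-map suc (upTo c)) (length-upTo c)

map-unique : ∀ {g xs} → Unique xs → InjectiveOn g xs → Unique (map g xs)
map-unique []       inj = []
map-unique (px ∷ p) inj =
  Allₚ.map⁺ (All.tabulate λ z∈ eq → All.lookup px z∈ (inj (here refl) (there z∈) eq)) ∷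
  map-unique p (λ x∈ y∈ → inj (there x∈) (there y∈))

orient-↭ : ∀ β T → orient β T ↭ T
orient-↭ true  T = ↭-refl
orient-↭ false T = ↭-reverse T

∈-binary⁻ : ∀ {x} T b → x ∈ binary T b → x ∈ T
∈-binary⁻ T (β ∷ b) x∈ with ∈-++⁻ (orient β T) x∈
... | inj₁ x∈T = ∈-resp-↭ (orient-↭ β T) x∈T
... | inj₂ x∈b = ∈-binary⁻ T b x∈b

map-binary : ∀ h T b → map h (binary T b) ≡ binary (map h T) b
map-binary h T []      = refl
map-binary h T (β ∷ b) =
  trans (map-++ h (orient β T) (binary T b)) (cong₂ _++_ (map-orient β) (map-binary h T b))
  where
  map-orient : ∀ β → map h (orient β T) ≡ orient β (map h T)
  map-orient true  = refl
  map-orient false = reverse-map h T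

module _ {P : ℕ → Set} (P? : ∀ x → Dec (P x)) where

  filter-reverse : ∀ xs → filter P? (reverse xs) ≡ reverse (filter P? xs)
  filter-reverse [] = refl
  filter-reverse (x ∷ xs) = begin
    filter P? (reverse (x ∷ xs))                ≡⟨ cong (filter P?) (unfold-reverse x xs) ⟩
    filter P? (reverse xs ++ [ x ])             ≡⟨ filter-++ P? (reverse xs) [ x ] ⟩
    filter P? (reverse xs) ++ filter P? [ x ]   ≡⟨ cong (_++ _) (filter-reverse xs) ⟩
    reverse (filter P? xs) ++ filter P? [ x ]   ≡⟨ snoc ⟩
    reverse (filter P? (x ∷ xs))                ∎
    where
    open ≡-Reasoning
    snoc : reverse (filter P? xs) ++ filter P? [ x ] ≡ reverse (filter P? (x ∷ xs))
    snoc with P? x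
    ... | yes _ = sym (unfold-reverse x (filter P? xs))
    ... | no  _ = ++-identityʳ _

  filter-binary : ∀ T b → filter P? (binary T b) ≡ binary (filter P? T) b
  filter-binary T []      = refl
  filter-binary T (β ∷ b) =
    trans (filter-++ P? (orient β T) (binary T b)) (cong₂ _++_ (filter-orient β) (filter-binary T b))
    where
    filter-orient : ∀ β → filter P? (orient β T) ≡ orient β (filter P? T)
    filter-orient true  = refl
    filter-orient false = filter-reverse T

binary-formation : ∀ {L} → Unique L → ∀ b → IsFormation (length L) (length b) (binary L b)
binary-formation {L} uniq b =
  L , refl , uniq , map (λ β → orient β L) b , length-map _ b ,
  Allₚ.map⁺ (All.universal (λ β → orient-↭ β L) b) , refl

-- Two alphabets of equal size differ by an injective renaming, which turns one binary formation
-- into the other.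
Embeds-binary : ∀ {T T′ u} b → Unique T → Unique T′ → length T ≡ length T′ →
                Embeds (binary T b) u → Embeds (binary T′ b) u
Embeds-binary {T} {T′} {u} b uniq uniq′ len emb
  with h , inj , refl ← injectiveRelabelling (SamePattern-unique uniq uniq′ len) =
  subst (λ w → Embeds w u) (map-binary h T b)
    (Embeds-map (λ x∈ y∈ → inj (∈-binary⁻ T b x∈) (∈-binary⁻ T b y∈)) emb)

BinaryForced : ℕ → Seq → ℕ → Set
BinaryForced c u s = ∀ b → length b ≡ s → Contains (binary (I c) b) u

binaryForced? : ∀ c u s → Dec (BinaryForced c u s)
binaryForced? c u = allWords? (λ b → contains? (binary (I c) b) u)

binaryForced⇒forced : ∀ {c u s} → BinaryForced c u s → FormationForced u s
binaryForced⇒forced {c} {u} {s} forced = formationBound c s , embed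
  where
  embed : ∀ w → IsFormation (formationBound c s) s w → Contains w u
  embed _ (L , lenL , uniqL , ps , refl , ps↭L , refl)
    with T , T⊆L , lenT , b , lenᵇ , Tb⊆w ←
      formation⊇binary c uniqL
        (All.map (λ p↭L → Unique-resp-↭ (↭-sym p↭L) uniqL ,
                          All.tabulate (∈-resp-↭ (↭-sym p↭L))) ps↭L)
        (≤-reflexive (sym lenL)) =
    embeds⇒contains (Embeds-⊆ Tb⊆w
      (Embeds-binary b (I-unique c) (AllPairs-resp-⊆ T⊆L uniqL) (trans (length-I c) (sym lenT))
        (contains⇒embeds (forced b lenᵇ))))

-- Forcing is applied to the formation on `I r` with orientations `b`. Its restriction to the
-- letters of the copy of `u` keeps the copy and the orientations and has `c` letters, which are
-- then renamed to `I c`.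
forced⇒binaryForced : ∀ {c u s} → (∀ {x} → x ∈ u → x ∈ I c) → (∀ {x} → x ∈ I c → x ∈ u) →
                      FormationForced u s → BinaryForced c u s
forced⇒binaryForced {c} {u} u⊆I I⊆u (r , forced) b refl
  with g , inj , gu⊆w ← contains⇒embeds
    (forced (binary (I r) b)
      (subst (λ k → IsFormation k (length b) (binary (I r) b)) (length-I r) (binary-formation (I-unique r) b))) =
  embeds⇒contains (Embeds-binary b uniqT (I-unique c) (trans lenT (sym (length-I c))) (g , inj , gu⊆Tb))
  where
  t T : Seq
  t = map g u
  T = filter (_∈? t) (I r)
  uniqT : Unique T
  uniqT = Unique.filter⁺ (_∈? t) (I-unique r)
  gu⊆Tb : t ⊆ binary T b
  gu⊆Tb = subst₂ _⊆_ (filter-all (_∈? t) (All.tabulate id)) (filter-binary (_∈? t) (I r) b)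
            (Sublist.filter⁺ (_∈? t) (_∈? t) (λ { refl → id }) gu⊆w)
  T≡gI : ∀ {x} → x ∈ T → x ∈ map g (I c)
  T≡gI x∈T with y , y∈u , refl ← ∈-map⁻ g (proj₂ (∈-filter⁻ (_∈? t) {xs = I r} x∈T)) = ∈-map⁺ g (u⊆I y∈u)
  gI≡T : ∀ {x} → x ∈ map g (I c) → x ∈ T
  gI≡T x∈gI with y , y∈I , refl ← ∈-map⁻ g x∈gI =
    ∈-filter⁺ (_∈? t) (∈-binary⁻ (I r) b (lookup gu⊆w gy∈t)) gy∈t
    where gy∈t = ∈-map⁺ g (I⊆u y∈I)
  lenT : length T ≡ c
  -- `T` and the image of `I c` have the same letters, each once, so one is a permutation of the
  -- other.
  lenT = trans (↭-length (∼bag⇒↭ (unique∧set⇒bag uniqT (map-unique (I-unique c) inj′) (mk⇔ T≡gI gI≡T))))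
           (trans (length-map g (I c)) (length-I c))
    where
    inj′ : InjectiveOn g (I c)
    inj′ x∈ y∈ = inj (I⊆u x∈) (I⊆u y∈)

-- Weak descents

-- Reading `y` after `p` in a power of `I c` requires a new factor exactly when `y ≤ p`; this is the
-- cost of that step.
fall : ℕ → ℕ → ℕ
fall p y with p <? y
... | yes _ = 0
... | no  _ = 1

fall-< : ∀ {p y} → p < y → fall p y ≡ 0
fall-< {p} {y} p<y with p <? y
... | yes _  = refl
... | no p≮y = contradiction p<y p≮y

fall-≥ : ∀ {p y} → y ≤ p → fall p y ≡ 1
fall-≥ {p} {y} y≤p with p <? y
... | yes p<y = contradiction p<y (≤⇒≯ y≤p)
... | no _    = refl

fall≤1 : ∀ p y → fall p y ≤ 1
fall≤1 p y with p <? y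
... | yes _ = z≤n
... | no _  = ≤-refl

fall-triangle : ∀ p y z → fall p z ≤ fall p y + fall y z
fall-triangle p y z with p <? y | y <? z
... | no _    | _       = ≤-trans (fall≤1 p z) (m≤m+n 1 _)
... | yes _   | no _    = fall≤1 p z
... | yes p<y | yes y<z = ≤-reflexive (fall-< (<-trans p<y y<z))

fall-swap : ∀ {x y} → x ≢ y → fall x y + fall y x ≡ 1
fall-swap {x} {y} x≢y with x <? y
... | yes x<y = fall-≥ (<⇒≤ x<y)
... | no x≮y  = cong suc (fall-< (≤∧≢⇒< (≮⇒≥ x≮y) (x≢y ∘ sym)))

-- The number of weak descents of p ∷ v.
falls : ℕ → Seq → ℕ
falls p []      = 0
falls p (y ∷ v) = fall p y + falls y v

end : ℕ → Seq → ℕ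
end p []      = p
end p (y ∷ v) = end y v

end-++ : ∀ p v w → end p (v ++ w) ≡ end (end p v) w
end-++ p []      w = refl
end-++ p (y ∷ v) w = end-++ y v w

falls-++ : ∀ p v w → falls p (v ++ w) ≡ falls p v + falls (end p v) w
falls-++ p []      w = refl
falls-++ p (y ∷ v) w = trans (cong (fall p y +_) (falls-++ y v w)) (sym (+-assoc (fall p y) _ _))

falls-insert : ∀ p y v → falls p v ≤ fall p y + falls y v
falls-insert p y []      = z≤n
falls-insert p y (z ∷ v) =
  ≤-trans (+-monoˡ-≤ (falls z v) (fall-triangle p y z)) (≤-reflexive (+-assoc (fall p y) _ _))

-- By `fall-triangle`, skipping a letter replaces two steps by one that costs no more.
falls-⊆ : ∀ {p v w} → v ⊆ w → falls p v ≤ falls p w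
falls-⊆ [] = z≤n
falls-⊆ {p} {v} (y ∷ʳ v⊆w) = ≤-trans (falls-insert p y v) (+-monoʳ-≤ (fall p y) (falls-⊆ v⊆w))
falls-⊆ {p} (_∷_ {x = y} refl v⊆w) = +-monoʳ-≤ (fall p y) (falls-⊆ v⊆w)

-- If the last letter is at most `x`, the walk from `x` to it cannot rise at every step.
fall-end≤falls : ∀ x y τ → fall x (end y τ) ≤ fall x y + falls y τ
fall-end≤falls x y []      = m≤m+n (fall x y) 0
fall-end≤falls x y (z ∷ τ) =
  ≤-trans (fall-end≤falls x z τ) (falls-insert x y (z ∷ τ))

falls-increasing : ∀ (f : ℕ → ℕ) n → (∀ i → f i < f (suc i)) → falls (f 0) (applyUpTo (f ∘ suc) n) ≡ 0
falls-increasing f zero    incr = refl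
falls-increasing f (suc n) incr = cong₂ _+_ (fall-< (incr 0)) (falls-increasing (f ∘ suc) n (incr ∘ suc))

falls-decreasing : ∀ (f : ℕ → ℕ) n → (∀ i → f (suc i) ≤ f i) → falls (f 0) (applyUpTo (f ∘ suc) n) ≡ n
falls-decreasing f zero    decr = refl
falls-decreasing f (suc n) decr = cong₂ _+_ (fall-≥ (decr 0)) (falls-decreasing (f ∘ suc) n (decr ∘ suc))

I≡applyUpTo : ∀ c → I c ≡ applyUpTo suc c
I≡applyUpTo c = map-upTo suc c

-- The word increases, so only the step into its first letter can descend.
falls-I≤1 : ∀ p r → falls p (I r) ≤ 1
falls-I≤1 p r rewrite I≡applyUpTo r with r
... | zero   = z≤n
... | suc r′ = subst (λ k → fall p 1 + k ≤ 1) (sym (falls-increasing suc r′ (λ _ → ≤-refl)))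
                 (≤-trans (≤-reflexive (+-identityʳ _)) (fall≤1 p 1))

falls-powI≤ : ∀ p r N → falls p (pow (I r) N) ≤ N
falls-powI≤ p r zero    = z≤n
falls-powI≤ p r (suc N) = ≤-trans (≤-reflexive (falls-++ p (I r) (pow (I r) N)))
                            (+-mono-≤ (falls-I≤1 p r) (falls-powI≤ _ r N))

drop-applyUpTo : ∀ (f : ℕ → ℕ) {j c} → j < c → drop j (applyUpTo f c) ≡ f j ∷ drop (suc j) (applyUpTo f c)
drop-applyUpTo f {zero}  (s≤s _)   = refl
drop-applyUpTo f {suc j} (s≤s j<c) = drop-applyUpTo (f ∘ suc) j<c

drop-I : ∀ {j c} → j < c → drop j (I c) ≡ suc j ∷ drop (suc j) (I c)
drop-I {j} {c} j<c rewrite I≡applyUpTo c = drop-applyUpTo suc j<c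

∈-I⁻ : ∀ {x c} → x ∈ I c → ∃ λ j → j < c × x ≡ suc j
∈-I⁻ {c = c} x∈I with j , j∈ , refl ← ∈-map⁻ suc x∈I = j , ∈-upTo⁻ j∈ , refl

-- Greedy reading: `drop p (I c)` is what remains of the current factor after the letter `p`, and a
-- new factor is opened at each weak descent.
⊆-powI : ∀ {c} p v → All (_∈ I c) v → v ⊆ drop p (I c) ++ pow (I c) (falls p v)
⊆-powI p []      _ = minimum _
⊆-powI {c} p (y ∷ v) (y∈ ∷ v∈) with j , j<c , refl ← ∈-I⁻ y∈ = extend
  where
  rest : Seq
  rest = pow (I c) (falls (suc j) v)
  from-j : suc j ∷ v ⊆ drop j (I c) ++ rest
  from-j = subst (λ xs → suc j ∷ v ⊆ xs ++ rest) (sym (drop-I j<c)) (refl ∷ ⊆-powI (suc j) v v∈)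
  extend : suc j ∷ v ⊆ drop p (I c) ++ pow (I c) (fall p (suc j) + falls (suc j) v)
  extend with p <? suc j
  ... | yes (s≤s p≤j) = ⊆-trans from-j (Sublist.++⁺ (Sublist.drop⁺-≥ {xs = I c} p≤j) ⊆-refl)
  ... | no  _ = Sublist.++⁺ˡ (drop p (I c)) (⊆-trans from-j (Sublist.++⁺ (Sublist.drop-⊆ j (I c)) ⊆-refl))

-- Neighbouring letters are distinct, so each step descends in exactly one of the two directions.
-- The two ends are recorded because they determine the steps between consecutive copies.
falls-reverse : ∀ x τ → Unique (x ∷ τ) → ∃ λ τ′ → reverse (x ∷ τ) ≡ end x τ ∷ τ′ ×
                end (end x τ) τ′ ≡ x × falls x τ + falls (end x τ) τ′ ≡ length τ
falls-reverse x []      _ = [] , refl , refl , refl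
falls-reverse x (y ∷ τ) ((x≢y ∷ _) ∷ uniq) with τ′ , rev , end≡y , count ← falls-reverse y τ uniq =
  τ′ ++ [ x ] ,
  trans (unfold-reverse x (y ∷ τ)) (cong (_++ [ x ]) rev) ,
  end-++ z τ′ [ x ] ,
  (begin
    (fall x y + falls y τ) + falls z (τ′ ++ [ x ])
      ≡⟨ cong ((fall x y + falls y τ) +_) (falls-++ z τ′ [ x ]) ⟩
    (fall x y + falls y τ) + (falls z τ′ + (fall (end z τ′) x + 0))
      ≡⟨ cong (λ w → (fall x y + falls y τ) + (falls z τ′ + (fall w x + 0))) end≡y ⟩
    (fall x y + falls y τ) + (falls z τ′ + (fall y x + 0))
      ≡⟨ rearrange (fall x y) (falls y τ) (falls z τ′) (fall y x) ⟩
    (fall x y + fall y x) + (falls y τ + falls z τ′)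
      ≡⟨ cong₂ _+_ (fall-swap x≢y) count ⟩
    suc (length τ) ∎)
  where
  open ≡-Reasoning
  z : ℕ
  z = end y τ
  rearrange : ∀ a b c d → (a + b) + (c + (d + 0)) ≡ (a + d) + (b + c)
  rearrange = solve-∀

-- Weak descents of alternating powers

alternate : Seq → Seq → List ℕ → Seq
alternate P Q []       = []
alternate P Q (e ∷ es) = pow P e ++ alternate Q P es

oddSum evenSum : List ℕ → ℕ
oddSum []        = 0
oddSum (e ∷ es)  = e + evenSum es
evenSum []       = 0
evenSum (e ∷ es) = oddSum es

-- From the end of the previous copy, each copy costs its cyclic descents: those inside it and the
-- return to its first letter.
falls-pow-end : ∀ x τ e → falls (end x τ) (pow (x ∷ τ) e) ≡ e * (falls x τ + fall (end x τ) x)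
falls-pow-end x τ zero    = refl
falls-pow-end x τ (suc e) =
  trans (falls-++ (end x τ) (x ∷ τ) (pow (x ∷ τ) e))
    (cong₂ _+_ (+-comm (fall (end x τ) x) (falls x τ)) (falls-pow-end x τ e))

end-pow : ∀ p x τ e → end p (pow (x ∷ τ) (suc e)) ≡ end x τ
end-pow p x τ zero    = end-++ p (x ∷ τ) []
end-pow p x τ (suc e) = trans (end-++ p (x ∷ τ) (pow (x ∷ τ) (suc e))) (end-pow (end x τ) x τ e)

-- Each block P^e costs e (a + δ) + δ′, where a counts the weak descents inside
-- P, δ the step from the end of P to its start, and δ′ = 1 − δ.
falls-alternate : ∀ p x z τ τ′ es → end x τ ≡ z → end z τ′ ≡ x → fall x z + fall z x ≡ 1 →
  fall p x ≡ 1 → All (1 ≤_) es →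
  falls p (alternate (x ∷ τ) (z ∷ τ′) es) ≡
    oddSum es * (falls x τ + fall z x) + evenSum es * (falls z τ′ + fall x z)
    + ⌈ length es /2⌉ * fall x z + ⌊ length es /2⌋ * fall z x
falls-alternate p x z τ τ′ [] _ _ _ _ _ = refl
falls-alternate p x _ τ τ′ (suc e ∷ es) refl back sum p≥x (s≤s _ ∷ es≥1) = begin
  falls p (pow P (suc e) ++ alternate Q P es)
    ≡⟨ falls-++ p (pow P (suc e)) (alternate Q P es) ⟩
  falls p (pow P (suc e)) + falls (end p (pow P (suc e))) (alternate Q P es)
    ≡⟨ cong₂ (λ k q → k + falls q (alternate Q P es)) first (end-pow p x τ e) ⟩
  suc e * d + fall x z + falls z (alternate Q P es)
    -- `Q` begins with the letter `z` on which `P` ends. This repetition is a weak descent, so the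
    -- assumption on the entering step holds for the next block too.
    ≡⟨ cong (suc e * d + fall x z +_)
         (falls-alternate z z x τ′ τ es back refl (trans (+-comm (fall z x) _) sum) (fall-≥ {z} ≤-refl) es≥1) ⟩
  suc e * d + fall x z
    + (oddSum es * d′ + evenSum es * d + ⌈ length es /2⌉ * fall z x + ⌊ length es /2⌋ * fall x z)
    ≡⟨ collect (suc e) d d′ (oddSum es) (evenSum es) ⌈ length es /2⌉ ⌊ length es /2⌋ (fall x z) (fall z x) ⟩
  (suc e + evenSum es) * d + oddSum es * d′
    + (1 + ⌊ length es /2⌋) * fall x z + ⌈ length es /2⌉ * fall z x ∎
  where
  open ≡-Reasoning
  P Q : Seq
  z d d′ : ℕ
  z = end x τ
  P = x ∷ τ
  Q = z ∷ τ′
  d  = falls x τ + fall z x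
  d′ = falls z τ′ + fall x z
  collect : ∀ e d d′ o v c f s t →
    e * d + s + (o * d′ + v * d + c * t + f * s) ≡ (e + v) * d + o * d′ + (1 + f) * s + c * t
  collect = solve-∀
  shift : ∀ a b s t → (s + t) + a + b ≡ (a + t) + b + s
  shift = solve-∀
  -- The entering step costs 1, which is `fall x z + fall z x`. The second term completes the cyclic
  -- cost of the first copy, and the first is the surplus of the block.
  first : falls p (pow P (suc e)) ≡ suc e * d + fall x z
  first = begin
    falls p (P ++ pow P e)                       ≡⟨ falls-++ p P (pow P e) ⟩
    fall p x + falls x τ + falls z (pow P e)     ≡⟨ cong₂ (λ k l → k + falls x τ + l) (trans p≥x (sym sum)) (falls-pow-end x τ e) ⟩
    fall x z + fall z x + falls x τ + e * d      ≡⟨ shift (falls x τ) (e * d) (fall x z) (fall z x) ⟩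
    d + e * d + fall x z                         ∎

tabulate-flip : ∀ {A : Set} {n} (x y : Fin n → A) →
  tabulate (λ i → if isEven (suc (toℕ i)) then x i else y i) ≡
  tabulate (λ i → if isEven (toℕ i) then y i else x i)
tabulate-flip x y = tabulate-cong (λ i → if-not (isEven (toℕ i)))
  where
  if-not : ∀ {A : Set} b {x y : A} →
           (if (if b then false else true) then x else y) ≡ (if b then y else x)
  if-not true  = refl
  if-not false = refl

-- Dropping the first exponent flips the parity of all positions, which `alternate` expresses by
-- exchanging its two blocks.
alternate-tabulate : ∀ P Q n (e : Fin n → ℕ) →
  concat (tabulate λ i → if isEven (toℕ i) then pow P (e i) else pow Q (e i)) ≡
  alternate P Q (tabulate e)
alternate-tabulate P Q zero    e = refl
alternate-tabulate P Q (suc n) e = cong (pow P (e Fin.zero) ++_)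
  (trans (cong concat (tabulate-flip (pow P ∘ e ∘ Fin.suc) (pow Q ∘ e ∘ Fin.suc)))
         (alternate-tabulate Q P n (e ∘ Fin.suc)))

mutual
  sumA≡oddSum : ∀ n (e : Fin n → ℕ) → sumA n e ≡ oddSum (tabulate e)
  sumA≡oddSum zero    e = refl
  sumA≡oddSum (suc n) e = cong (e Fin.zero +_)
    (trans (cong sum (tabulate-flip (e ∘ Fin.suc) (λ _ → 0))) (sumB≡evenSum n (e ∘ Fin.suc)))

  sumB≡evenSum : ∀ n (e : Fin n → ℕ) → sumB n e ≡ evenSum (tabulate e)
  sumB≡evenSum zero    e = refl
  sumB≡evenSum (suc n) e =
    trans (cong sum (tabulate-flip (λ _ → 0) (e ∘ Fin.suc))) (sumA≡oddSum n (e ∘ Fin.suc))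

n/2≡⌊n/2⌋ : ∀ n → n / 2 ≡ ⌊ n /2⌋
n/2≡⌊n/2⌋ zero          = refl
n/2≡⌊n/2⌋ (suc zero)    = refl
n/2≡⌊n/2⌋ (suc (suc n)) =
  trans (m/n≡1+[m∸n]/n {suc (suc n)} {2} (s≤s (s≤s z≤n))) (cong suc (n/2≡⌊n/2⌋ n))

map-pow : ∀ g P e → map g (pow P e) ≡ pow (map g P) e
map-pow g P zero    = refl
map-pow g P (suc e) = trans (map-++ g P (pow P e)) (cong (map g P ++_) (map-pow g P e))

map-alternate : ∀ g P Q es → map g (alternate P Q es) ≡ alternate (map g P) (map g Q) es
map-alternate g P Q []       = refl
map-alternate g P Q (e ∷ es) =
  trans (map-++ g (pow P e) (alternate Q P es)) (cong₂ _++_ (map-pow g P e) (map-alternate g Q P es))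

∈-pow⁻ : ∀ {x} P e → x ∈ pow P e → x ∈ P
∈-pow⁻ P (suc e) x∈ = [ id , ∈-pow⁻ P e ]′ (∈-++⁻ P x∈)

∈-alternate⁻ : ∀ {x} P Q es → x ∈ alternate P Q es → x ∈ P ⊎ x ∈ Q
∈-alternate⁻ P Q (e ∷ es) x∈ =
  [ inj₁ ∘ ∈-pow⁻ P e , Sum.swap ∘ ∈-alternate⁻ Q P es ]′ (∈-++⁻ (pow P e) x∈)

∈-alternate-reverse⁻ : ∀ {x} T es → x ∈ alternate T (reverse T) es → x ∈ T
∈-alternate-reverse⁻ T es x∈ =
  [ id , ∈-resp-↭ (↭-reverse T) ]′ (∈-alternate⁻ T (reverse T) es x∈)

∈-alternate⁺ : ∀ {x P Q e es} → 1 ≤ e → x ∈ P → x ∈ alternate P Q (e ∷ es)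
∈-alternate⁺ {P = P} {e = suc e} _ x∈P = ∈-++⁺ˡ (∈-++⁺ˡ {xs = P} {ys = pow P e} x∈P)

end-∈ : ∀ y τ → end y τ ∈ y ∷ τ
end-∈ y []      = here refl
end-∈ y (z ∷ τ) = there (end-∈ z τ)

fall-cycle≤falls : ∀ x τ → end x τ ≢ x → fall x (end x τ) ≤ falls x τ
fall-cycle≤falls x []      z≢x = contradiction refl z≢x
fall-cycle≤falls x (y ∷ τ) _   = fall-end≤falls x y τ

module _ (p x y : ℕ) (τ₁ : Seq) (uniq : Unique (x ∷ y ∷ τ₁)) (p≥x : fall p x ≡ 1) where

  private
    τ : Seq
    τ = y ∷ τ₁
    z : ℕ
    z = end x τ

  -- There are at least two distinct letters, so the ends `x` and `z` differ and just one of the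
  -- steps between them descends. The two inequalities hold because a descent from one end to the
  -- other forces a descent along the word; they keep both cyclic counts positive in `cost-bound`.
  falls-alternate-reverse : ∀ es → All (1 ≤_) es → ∃ λ a′ →
    falls x τ + a′ ≡ length τ × fall x z + fall z x ≡ 1 × fall x z ≤ falls x τ × fall z x ≤ a′ ×
    falls p (alternate (x ∷ τ) (reverse (x ∷ τ)) es) ≡
      oddSum es * (falls x τ + fall z x) + evenSum es * (a′ + fall x z)
      + ⌈ length es /2⌉ * fall x z + ⌊ length es /2⌋ * fall z x
  falls-alternate-reverse es es≥1 with τ′ , rev , back , count ← falls-reverse x τ uniq =
    falls z τ′ , count , cross , fall-cycle≤falls x τ (x≢z ∘ sym) ,
    subst (λ w → fall z w ≤ falls z τ′) back (fall-cycle≤falls z τ′ (λ eq → x≢z (trans (sym back) eq))) ,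
    trans (cong (λ Q → falls p (alternate (x ∷ τ) Q es)) rev)
          (falls-alternate p x z τ τ′ es refl back cross p≥x es≥1)
    where
    x≢z : x ≢ z
    x≢z = All.lookup (AllPairs.head uniq) (end-∈ y τ₁)
    cross : fall x z + fall z x ≡ 1
    cross = fall-swap x≢z

-- `A + B` is the sum of the minimum and the maximum, and `A * i + B * j` is at least `i + j` times
-- the minimum. The weights `suc i` and `suc j` stand for the cyclic descents of a word and of its
-- reversal.
weighted-min-max : ∀ A B i j → suc (i + j) * (A ⊓ B) + (A ⊔ B) ≤ A * suc i + B * suc j
weighted-min-max A B i j with ≤-total A B
... | inj₁ A≤B rewrite m≤n⇒m⊓n≡m A≤B | m≤n⇒m⊔n≡n A≤B =
  ≤-trans (≤-reflexive (split A B i j))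
    (≤-trans (+-monoʳ-≤ (A * suc i + B) (*-monoˡ-≤ j A≤B)) (≤-reflexive (join A B i j)))
  where
  split : ∀ A B i j → suc (i + j) * A + B ≡ A * suc i + B + A * j
  split = solve-∀
  join : ∀ A B i j → A * suc i + B + B * j ≡ A * suc i + B * suc j
  join = solve-∀
... | inj₂ B≤A rewrite m≥n⇒m⊓n≡n B≤A | m≥n⇒m⊔n≡m B≤A =
  ≤-trans (≤-reflexive (split A B i j))
    (≤-trans (+-monoʳ-≤ (B * suc j + A) (*-monoˡ-≤ i B≤A)) (≤-reflexive (join A B i j)))
  where
  split : ∀ A B i j → suc (i + j) * B + A ≡ B * suc j + A + B * i
  split = solve-∀
  join : ∀ A B i j → B * suc j + A + A * i ≡ A * suc i + B * suc j
  join = solve-∀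

-- The cyclic descents `a + δ` and `a′ + δ′` are both positive and add up to `suc k`. In addition
-- each block of one kind costs one factor: the blocks in even places if `δ` is 1, and those in odd
-- places, at least as many, if `δ′` is 1.
cost-bound : ∀ A B l k a a′ δ δ′ → a + a′ ≡ k → δ′ + δ ≡ 1 → δ′ ≤ a → δ ≤ a′ →
  k * (A ⊓ B) + (A ⊔ B) + ⌊ l /2⌋ ≤ A * (a + δ) + B * (a′ + δ′) + ⌈ l /2⌉ * δ′ + ⌊ l /2⌋ * δ
cost-bound A B l _ a (suc a′) 1 zero refl _ _ _ = begin
  (a + suc a′) * (A ⊓ B) + (A ⊔ B) + h                ≡⟨ cong (λ k → k * (A ⊓ B) + (A ⊔ B) + h) (+-suc a a′) ⟩
  suc (a + a′) * (A ⊓ B) + (A ⊔ B) + h                ≤⟨ +-monoˡ-≤ h (weighted-min-max A B a a′) ⟩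
  A * suc a + B * suc a′ + h                           ≡⟨ tidy A B a a′ ⌈ l /2⌉ h ⟩
  A * (a + 1) + B * (suc a′ + 0) + ⌈ l /2⌉ * 0 + h * 1 ∎
  where
  open ≤-Reasoning
  h : ℕ
  h = ⌊ l /2⌋
  tidy : ∀ A B a a′ H h → A * suc a + B * suc a′ + h ≡ A * (a + 1) + B * (suc a′ + 0) + H * 0 + h * 1
  tidy = solve-∀
cost-bound A B l _ (suc a) a′ zero 1 refl _ _ _ = begin
  suc (a + a′) * (A ⊓ B) + (A ⊔ B) + ⌊ l /2⌋           ≤⟨ +-mono-≤ (weighted-min-max A B a a′) (⌊n/2⌋≤⌈n/2⌉ l) ⟩
  A * suc a + B * suc a′ + ⌈ l /2⌉                     ≡⟨ tidy A B a a′ ⌈ l /2⌉ ⌊ l /2⌋ ⟩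
  A * (suc a + 0) + B * (a′ + 1) + ⌈ l /2⌉ * 1 + ⌊ l /2⌋ * 0 ∎
  where
  open ≤-Reasoning
  tidy : ∀ A B a a′ H h → A * suc a + B * suc a′ + H ≡ A * (suc a + 0) + B * (a′ + 1) + H * 1 + h * 0
  tidy = solve-∀
cost-bound A B l _ a    zero 1             zero           _ _   _  ()
cost-bound A B l _ zero _    zero          1              _ _   () _
cost-bound A B l _ _    _    zero          zero           _ ()  _  _
cost-bound A B l _ _    _    zero          (suc (suc δ′)) _ ()  _  _
cost-bound A B l _ _    _    (suc (suc δ)) zero           _ ()  _  _
cost-bound A B l _ _    _    (suc δ)       (suc δ′)       _ sum _  _ =
  contradiction (suc-injective sum) (m+1+n≢0 δ′)

-- Bounds on the formation width

pow≡binary : ∀ T e → pow T e ≡ binary T (replicate e true)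
pow≡binary T zero    = refl
pow≡binary T (suc e) = cong (T ++_) (pow≡binary T e)

Embeds-pow : ∀ {T T′ u} e → Unique T → Unique T′ → length T ≡ length T′ →
             Embeds (pow T e) u → Embeds (pow T′ e) u
Embeds-pow {T} {T′} {u} e uniq uniq′ len emb =
  subst (λ w → Embeds w u) (sym (pow≡binary T′ e))
    (Embeds-binary (replicate e true) uniq uniq′ len
      (subst (λ w → Embeds w u) (pow≡binary T e) emb))

-- Pigeonhole: each block is used by the power of its own orientation and skipped by the other.
binary-majority : ∀ T m n b → m + n ≤ suc (length b) →
                  pow T m ⊆ binary T b ⊎ pow (reverse T) n ⊆ binary T b
binary-majority T zero    n       b           le = inj₁ (minimum _)
binary-majority T (suc m) zero    b           le = inj₂ (minimum _)
binary-majority T (suc m) (suc n) []          (s≤s le) = contradiction (n≤0⇒n≡0 le) (m+1+n≢0 m)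
binary-majority T (suc m) (suc n) (true ∷ b)  (s≤s le) =
  Sum.map (Sublist.++⁺ ⊆-refl) (Sublist.++⁺ˡ T) (binary-majority T m (suc n) b le)
binary-majority T (suc m) (suc n) (false ∷ b) (s≤s le) =
  Sum.map (Sublist.++⁺ˡ (reverse T)) (Sublist.++⁺ ⊆-refl)
    (binary-majority T (suc m) n b (subst (_≤ suc (length b)) (+-suc m n) le))

D-unique : ∀ c → Unique (D c)
D-unique c = Unique-resp-↭ (↭-sym (↭-reverse (I c))) (I-unique c)

-- Some `X` of the blocks have the same orientation. If that is `D c`, a renaming of the letters
-- carries the embedding over from the power of `I c`.
embeds-powI⇒binaryForced : ∀ {c u X} → Embeds (pow (I c) X) u → BinaryForced c u (2 * X ∸ 1)
embeds-powI⇒binaryForced {c} {u} {X} emb b len =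
  embeds⇒contains ([ (λ sub → Embeds-⊆ sub emb)
                   , (λ sub → Embeds-⊆ sub (Embeds-pow X (I-unique c) (D-unique c) len-ID emb)) ]′
    (binary-majority (I c) X X b enough))
  where
  len-ID : length (I c) ≡ length (D c)
  len-ID = sym (length-reverse (I c))
  enough : X + X ≤ suc (length b)
  enough = subst₂ (λ p q → p ≤ suc q) (cong (X +_) (+-identityʳ X)) (sym len) (m≤n+m∸n (2 * X) 1)

module _ (k : ℕ) (es : List ℕ) (es≥1 : All (1 ≤_) es) where

  private
    c A B h : ℕ
    c = suc (suc k)
    A = oddSum es
    B = evenSum es
    h = ⌊ length es /2⌋
    u : Seq
    u = alternate (I c) (D c) es
    X : ℕ
    X = suc k * (A ⊓ B) + (A ⊔ B) + h

  map-u : ∀ g → map g u ≡ alternate (map g (I c)) (reverse (map g (I c))) es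
  map-u g = trans (map-alternate g (I c) (D c) es)
              (cong (λ Q → alternate (map g (I c)) Q es) (reverse-map g (I c)))

  -- The copy of `u` again alternates between an order of the letters and its reversal, so it has at
  -- least `X` weak descents by `cost-bound`. As a sublist of the power it has at most `N`.
  embeds-pow⇒≥ : ∀ {r N} → (∀ {x} → x ∈ I c → x ∈ u) → Embeds (pow (I r) N) u → X ≤ N
  embeds-pow⇒≥ {r} {N} I⊆u (g , inj , gu⊆w)
    with a′ , count , cross , δ′≤a , δ≤a′ , cost ←
      -- The count starts from the first letter of the copy itself, so that entering it costs one.
      falls-alternate-reverse (g 1) (g 1) (g 2) _
        (map-unique (I-unique c) (λ x∈ y∈ → inj (I⊆u x∈) (I⊆u y∈)))
        (fall-≥ {g 1} ≤-refl) es es≥1 = begin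
    X                                                     ≤⟨ cost-bound A B (length es) (suc k) _ a′ _ _ a+a′ cross δ′≤a δ≤a′ ⟩
    _                                                     ≡⟨ cost ⟨
    falls (g 1) (alternate (map g (I c)) (reverse (map g (I c))) es) ≡⟨ cong (falls (g 1)) (map-u g) ⟨
    falls (g 1) (map g u)                                 ≤⟨ falls-⊆ gu⊆w ⟩
    falls (g 1) (pow (I r) N)                             ≤⟨ falls-powI≤ (g 1) r N ⟩
    N ∎
    where
    open ≤-Reasoning
    a+a′ = trans count (suc-injective (trans (length-map g (I c)) (length-I c)))

  -- Any order `T` of the letters is a possible image of `I c`, and `⊆-powI` converts its weak
  -- descents into factors.
  embeds-powI : ∀ {T} → Unique T → length T ≡ c → All (_∈ I c) T →
                Embeds (pow (I c) (falls c (alternate T (reverse T) es))) u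
  embeds-powI uniq len T⊆I
    with g , inj , refl ← injectiveRelabelling (SamePattern-unique (I-unique c) uniq (trans (length-I c) (sym len))) =
    g , (λ x∈ y∈ → inj (∈-alternate-reverse⁻ (I c) es x∈) (∈-alternate-reverse⁻ (I c) es y∈)) ,
    subst (_⊆ pow (I c) (falls c v)) (sym (map-u g))
      -- Counting from `c` means that the current factor is used up: `drop c (I c)` is empty.
      (subst (λ xs → v ⊆ xs ++ pow (I c) (falls c v)) (drop-all c (I c) (≤-reflexive (length-I c)))
        (⊆-powI c v (All.tabulate (λ x∈v → All.lookup T⊆I (∈-alternate-reverse⁻ (map g (I c)) es x∈v)))))
    where
    v : Seq
    v = alternate (map g (I c)) (reverse (map g (I c))) es

  -- With the smallest letter first, the return from the end to `1` descends and the step from `1`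
  -- to the end rises. The surplus therefore falls on the reversed blocks only, of which there are
  -- `h`.
  embeds-powI-from-1 : ∀ {y τ₁} a → Unique (1 ∷ y ∷ τ₁) → length (y ∷ τ₁) ≡ suc k →
                       All (_∈ I c) (1 ∷ y ∷ τ₁) → falls 1 (y ∷ τ₁) ≡ a → ∃ λ a′ → a + a′ ≡ suc k ×
                       Embeds (pow (I c) (A * suc a + B * a′ + h)) u
  embeds-powI-from-1 {y} {τ₁} a uniq len T⊆I refl
    with a′ , count , cross , _ , _ , cost ←
      falls-alternate-reverse c 1 y τ₁ uniq (fall-≥ {c} (s≤s z≤n)) es es≥1 =
    a′ , trans count len ,
    subst (λ N → Embeds (pow (I c) N) u) (trans cost simplified) (embeds-powI uniq (cong suc len) T⊆I)
    where
    z : ℕ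
    z = end y τ₁
    z-falls : fall z 1 ≡ 1
    z-falls with _ , _ , z≡ ← ∈-I⁻ (All.lookup T⊆I (there (end-∈ y τ₁))) =
      fall-≥ {z} (subst (1 ≤_) (sym z≡) (s≤s z≤n))
    1-rises : fall 1 z ≡ 0
    1-rises = +-cancelʳ-≡ 1 (fall 1 z) 0 (trans (cong (fall 1 z +_) (sym z-falls)) cross)
    tidy : ∀ A B a a′ H h → A * (a + 1) + B * (a′ + 0) + H * 0 + h * 1 ≡ A * suc a + B * a′ + h
    tidy = solve-∀
    simplified = trans
      (cong₂ (λ δ δ′ → A * (falls 1 (y ∷ τ₁) + δ) + B * (a′ + δ′) + ⌈ length es /2⌉ * δ′ + h * δ) z-falls 1-rises)
      (tidy A B (falls 1 (y ∷ τ₁)) a′ ⌈ length es /2⌉ h)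

  -- In the natural order a copy of `I c` costs one factor and a copy of `D c` costs `suc k`.
  embeds-powI-increasing : Embeds (pow (I c) (A * 1 + B * suc k + h)) u
  embeds-powI-increasing
    with _ , refl , emb ← embeds-powI-from-1 0 (I-unique c) (suc-injective (length-I c)) (All.tabulate id)
           (trans (cong (falls 1) (map-applyUpTo suc suc (suc k)))
                  (falls-increasing suc (suc k) (λ _ → ≤-refl))) = emb

  private
    c∸≥2 : ∀ {i} → i < suc k → 2 ≤ c ∸ i
    c∸≥2 {i} (s≤s i≤k) = subst (_≤ c ∸ i) (m+n∸n≡m 2 k) (∸-monoʳ-≤ c i≤k)
    distinct : ∀ {i j} → i < j → j < suc k → c ∸ i ≢ c ∸ j
    distinct i<j j<1+k eq =
      <⇒≢ i<j (∸-cancelˡ-≡ (<⇒≤ (<-trans i<j (m<n⇒m<1+n j<1+k))) (<⇒≤ (m<n⇒m<1+n j<1+k)) eq)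
    letter : ∀ {i} → i < suc k → c ∸ i ∈ I c
    letter {i} (s≤s i≤k) = subst (_∈ I c) (sym (+-∸-assoc 1 (m≤n⇒m≤1+n i≤k)))
      (∈-map⁺ suc (∈-upTo⁺ (s≤s (m∸n≤m (suc k) i))))

  -- The letters 1, c, c − 1, …, 2 in this order, whose reversal increases cyclically.
  embeds-powI-decreasing : Embeds (pow (I c) (A * suc k + B * 1 + h)) u
  embeds-powI-decreasing
    with a′ , count , emb ← embeds-powI-from-1 k
      (Allₚ.applyUpTo⁺₁ (c ∸_) (suc k) (λ i<1+k → <⇒≢ (c∸≥2 i<1+k)) ∷
       Unique.applyUpTo⁺₁ (c ∸_) (suc k) distinct)
      (length-applyUpTo (c ∸_) (suc k))
      (here refl ∷ Allₚ.applyUpTo⁺₁ (c ∸_) (suc k) letter)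
      (falls-decreasing (c ∸_) k (λ i → ∸-monoʳ-≤ c (n≤1+n i)))
    rewrite +-cancelˡ-≡ k a′ 1 (trans count (sym (+-comm k 1))) = emb

  -- The order is chosen so that the kind of block with the larger total exponent costs one factor
  -- per copy; the other kind then costs `suc k`.
  embeds-powI-X : Embeds (pow (I c) X) u
  embeds-powI-X with ≤-total A B
  ... | inj₁ A≤B rewrite m≤n⇒m⊓n≡m A≤B | m≤n⇒m⊔n≡n A≤B =
    subst (λ N → Embeds (pow (I c) (N + h)) u) (cong₂ _+_ (*-comm A (suc k)) (*-identityʳ B))
      embeds-powI-decreasing
  ... | inj₂ B≤A rewrite m≥n⇒m⊓n≡n B≤A | m≥n⇒m⊔n≡m B≤A =
    subst (λ N → Embeds (pow (I c) (N + h)) u)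
      (trans (cong₂ _+_ (*-identityʳ A) (*-comm B (suc k))) (+-comm A _))
      embeds-powI-increasing

  -- Forcing is equivalent to the decidable `BinaryForced`, which holds at `2 * X ∸ 1`, so a least
  -- such number can be found by search.
  formationWidth-alternate : (∀ {x} → x ∈ I c → x ∈ u) →
                             ∃ λ w → IsFormationWidth u w × X ≤ w × w ≤ 2 * X ∸ 1
  formationWidth-alternate I⊆u
    with w , w≤ , forced , minimal ←
      least (binaryForced? c u) (2 * X ∸ 1) (embeds-powI⇒binaryForced {X = X} embeds-powI-X) =
    w ,
    (binaryForced⇒forced {c} forced ,
     λ s s<w f → minimal s s<w (forced⇒binaryForced (∈-alternate-reverse⁻ (I c) es) I⊆u f)) ,
    -- The binary formation with all blocks equal to `I c` is a power, to which the descent count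
    -- applies.
    embeds-pow⇒≥ {c} I⊆u
      (subst (λ v → Embeds v u) (sym (pow≡binary (I c) w))
        (contains⇒embeds (forced (replicate w true) (length-replicate w)))) ,
    w≤

theorem1p5 : (c n : ℕ) (e : Fin n → ℕ) → 2 ≤ c → 1 ≤ n → (∀ i → 1 ≤ e i) →
    ∃ λ k → IsFormationWidth (altSeq c n e) k
    × ((c ∸ 1) * (sumA n e ⊓ sumB n e) + (sumA n e ⊔ sumB n e) + n / 2 ≤ k)
    × (k ≤ 2 * (c ∸ 1) * (sumA n e ⊓ sumB n e) + 2 * (sumA n e ⊔ sumB n e) + 2 * (n / 2) ∸ 1)
theorem1p5 (suc zero) _ _ (s≤s ())
theorem1p5 (suc (suc k)) n@(suc _) e _ _ e≥1 =
  bounded {suc k} (alternate-tabulate (I (suc (suc k))) (D (suc (suc k))) n e)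
    (sumA≡oddSum n e) (sumB≡evenSum n e)
    (trans (n/2≡⌊n/2⌋ n) (cong ⌊_/2⌋ (sym (length-tabulate e))))
    (formationWidth-alternate k (tabulate e) (Allₚ.tabulate⁺ e≥1) I⊆u)
  where
  -- The first block, a nonempty power of `I c`, already supplies every letter.
  I⊆u : ∀ {x} → x ∈ I (suc (suc k)) → x ∈ alternate (I (suc (suc k))) (D (suc (suc k))) (tabulate e)
  I⊆u = ∈-alternate⁺ {Q = D (suc (suc k))} {es = tabulate (e ∘ Fin.suc)} (e≥1 Fin.zero)
  distribute : ∀ c m M h → 2 * (c * m + M + h) ≡ 2 * c * m + 2 * M + 2 * h
  distribute = solve-∀
  -- Matching on the four equalities carries the result from the list of exponents over to the
  -- indexed form.
  bounded : ∀ {c u u′ A A′ B B′ h h′} → u ≡ u′ → A ≡ A′ → B ≡ B′ → h ≡ h′ →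
    (∃ λ w → IsFormationWidth u′ w × c * (A′ ⊓ B′) + (A′ ⊔ B′) + h′ ≤ w
                                   × w ≤ 2 * (c * (A′ ⊓ B′) + (A′ ⊔ B′) + h′) ∸ 1) →
    ∃ λ w → IsFormationWidth u w × (c * (A ⊓ B) + (A ⊔ B) + h ≤ w)
                                 × (w ≤ 2 * c * (A ⊓ B) + 2 * (A ⊔ B) + 2 * h ∸ 1)
  bounded {c} {A = A} {B = B} {h = h} refl refl refl refl (w , width , lower , upper) =
    w , width , lower ,
    ≤-trans upper (≤-reflexive (cong (_∸ 1) (distribute c (A ⊓ B) (A ⊔ B) h)))
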